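{- Let $Cr_{10}$ be the crown graph on $10$ vertices. Then $\mathrm{gon}_2(Cr_{10})=10-\alpha_2(Cr_{10})$.
   Context: The crown graph $Cr_{2n}$ is the complete bipartite graph $K_{n,n}$ with a perfect matching removed; $Cr_{10}$ is obtained from $K_{5,5}$. $\alpha_2(G)$ is the maximum size of a set of vertices with pairwise graph distance greater than $2$. A divisor is a formal integer combination $D=\sum_v D(v)(v)$ of vertices, $\deg D=\sum_v D(v)$, effective if all $D(v)\ge0$. Firing a vertex $v$ transforms $D$ into $D'$ with $D'(v)=D(v)-\mathrm{val}(v)$ and $D'(w)=D(w)+(\text{number of edges between } v,w)$ for $w\ne v$; linear equivalence is generated by firings. The rank $r(D)$ is $-1$ if $D$ is not equivalent to an effective divisor, and otherwise the largest $r\ge0$ such that $D-E$ is equivalent to an effective divisor for every effective $E$ of degree $r$. $\mathrm{gon}_2(G)$ is the minimum degree of a divisor of rank at least $2$. -}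

module Defs where

open import Data.Nat using (ℕ; zero; suc; _≤_; _<_)
open import Data.Integer as ℤ using (ℤ; +_; _-_)
open import Data.Fin using (Fin; splitAt; toℕ)
open import Data.Fin.Properties using (_≟_)
open import Data.Bool using (true; false; if_then_else_)
open import Data.Sum using (_⊎_; inj₁; inj₂)
open import Data.Product using (Σ; ∃; _×_; _,_)
import Data.Nat.ListAction
open import Data.List using (List; []; _∷_; map; foldr; length; allFin)
open import Data.List.Membership.Propositional using (_∈_)
open import Data.List.Relation.Unary.Unique.Propositional using (Unique)
open import Relation.Nullary using (¬_; does)
open import Relation.Binary.PropositionalEquality using (_≡_; _≢_)
open import Relation.Binary.Construct.Closure.Equivalence using (EqClosure)

-- Finite (multi)graphs on vertex set Fin N, given by edge multiplicities.

record Graph (N : ℕ) : Set where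
  field
    edges : Fin N → Fin N → ℕ
open Graph public

-- Crown graph Cr_{2n}: K_{n,n} minus a perfect matching.
-- Vertex i < n is a_i, vertex n + j is b_j; a_i ~ b_j iff i ≠ j.
crown : (n : ℕ) → Graph (n Data.Nat.+ n)
crown n = record { edges = e }
  where
  cross : Fin n → Fin n → ℕ
  cross i j = if does (i ≟ j) then 0 else 1
  e : Fin (n Data.Nat.+ n) → Fin (n Data.Nat.+ n) → ℕ
  e u v with splitAt n u | splitAt n v
  ... | inj₁ i | inj₂ j = cross i j
  ... | inj₂ i | inj₁ j = cross i j
  ... | inj₁ _ | inj₁ _ = 0
  ... | inj₂ _ | inj₂ _ = 0

Cr10 : Graph 10
Cr10 = crown 5

module _ {N : ℕ} (G : Graph N) where

  data Walk : Fin N → Fin N → ℕ → Set where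
    nil  : ∀ {u} → Walk u u 0
    cons : ∀ {u w v k} → 0 < edges G u w → Walk w v k → Walk u v (suc k)

  DistLE : Fin N → Fin N → ℕ → Set
  DistLE u v k = Σ ℕ λ m → m ≤ k × Walk u v m

  -- d(u,v) > 2   (includes d = ∞)
  DistGT2 : Fin N → Fin N → Set
  DistGT2 u v = ¬ DistLE u v 2

  Far2Set : List (Fin N) → Set
  Far2Set S = Unique S × (∀ {u v} → u ∈ S → v ∈ S → u ≢ v → DistGT2 u v)

  IsAlpha2 : ℕ → Set
  IsAlpha2 a = (Σ (List (Fin N)) λ S → Far2Set S × length S ≡ a)
             × (∀ S → Far2Set S → length S ≤ a)

  Divisor : Set
  Divisor = Fin N → ℤ

  sumℤ : List ℤ → ℤ
  sumℤ = foldr ℤ._+_ (+ 0)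

  deg : Divisor → ℤ
  deg D = sumℤ (map D (allFin N))

  Effective : Divisor → Set
  Effective D = ∀ v → + 0 ℤ.≤ D v

  val : Fin N → ℕ
  val v = Data.Nat.ListAction.sum (map (λ w → if does (w ≟ v) then 0 else edges G v w) (allFin N))

  fire : Fin N → Divisor → Divisor
  fire v D w = if does (w ≟ v) then D v - + val v else D w ℤ.+ + edges G v w

  FireStep : Divisor → Divisor → Set
  FireStep D D' = Σ (Fin N) λ v → ∀ w → D' w ≡ fire v D w

  _∼_ : Divisor → Divisor → Set
  _∼_ = EqClosure FireStep

  EquivEffective : Divisor → Set
  EquivEffective D = Σ Divisor λ D' → D ∼ D' × Effective D'

  _−_ : Divisor → Divisor → Divisor
  (D − E) v = D v - E v

  -- r(D) ≥ r : for every k ≤ r and every effective E of degree k,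
  -- D - E is equivalent to an effective divisor (k = 0 gives r(D) ≥ 0).
  RankAtLeast : ℕ → Divisor → Set
  RankAtLeast r D = ∀ k → k ≤ r → ∀ E → Effective E → deg E ≡ + k →
                    EquivEffective (D − E)

  IsGon2 : ℤ → Set
  IsGon2 g = (Σ Divisor λ D → RankAtLeast 2 D × deg D ≡ g)
           × (∀ D → RankAtLeast 2 D → g ℤ.≤ deg D)

{-# OPTIONS --safe #-}
-- α₂ = 2, because among three vertices two lie on the same side and have a common neighbour, whereas
-- a₀ and b₀ are at distance 3.  It remains to show gon₂ = 8.
--
-- Upper bound: V − a₀ − b₀ has rank 2, since subtracting any two chips leaves a divisor that becomes
-- effective after firing nothing, or everything except a set {a₀, v} or {b₀, v}.
--
-- Lower bound: if D has rank 2 and degree at most 7, then D − a₀ − a₁ is equivalent to an effective X of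
-- degree at most 5.  For each of the 3003 possible X there are vertices i and j such that a divisor
-- equivalent to X + a₀ + a₁ − i − j burns completely under Dhar's algorithm when the fire starts at the
-- vertices in debt.  Such a divisor F is not equivalent to any effective divisor: if firing σ made it
-- effective, no vertex where σ is maximal could ever catch fire.
module Submission where

open import Defs
open import Data.Bool using (true; false; if_then_else_; _∨_)
import Data.Bool.Properties as Bool
open import Data.Fin using (Fin; zero; suc; #_)
import Data.Fin.Properties as Fin
open import Data.Fin.Subset using (Subset; ⊥; ⊤)
open import Data.Integer using (ℤ; +_; _+_; _-_; -_; _*_; _≤_; _<_; _≤?_; _<?_; ∣_∣; +≤+)
import Data.Integer.Properties as ℤ
open import Algebra.Properties.Semiring.Sum ℤ.+-*-semiring
  using (sum; sum-syntax; sum-cong-≗; sum-replicate-zero; ∑-distrib-+; ∑-comm; *-distribˡ-sum; *-distribʳ-sum)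
open import Data.Integer.Tactic.RingSolver using (solve-∀)
open import Data.List using (List; []; _∷_; allFin; concatMap; filter; foldr; length; map; upTo)
open import Data.List.Extrema ℤ.≤-totalOrder using (argmax; f[xs]≤f[argmax])
import Data.List as List
open import Data.List.Membership.Propositional using (_∈_; lose)
open import Data.List.Membership.Propositional.Properties
  using (∈-allFin; ∈-concatMap⁺; ∈-map⁺; ∈-upTo⁺)
open import Data.List.Relation.Unary.All as All using (All; []; _∷_)
open import Data.List.Relation.Unary.AllPairs using ([]; _∷_)
open import Data.List.Relation.Unary.Any using (Any; any?; here; there; satisfied)
open import Data.Nat as ℕ using (ℕ; zero; suc; z≤n; s≤s)
import Data.Nat.ListAction as ℕ
import Data.Nat.Properties as ℕ
open import Data.Product using (Σ; ∃; _×_; _,_)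
open import Data.Sum using (_⊎_; inj₁; inj₂)
open import Data.Vec using (Vec; []; _∷_; lookup; tabulate)
import Data.Vec as Vec
import Data.Vec.Properties as Vec
open import Function using (_∘_)
open import Relation.Binary using (IsEquivalence)
open import Relation.Binary.Construct.Closure.Equivalence as EqClosure using ()
open import Relation.Binary.PropositionalEquality
open import Relation.Nullary using (¬_; Dec; yes; no; does; contradiction)
open import Relation.Nullary.Decidable using (¬?; _×-dec_; _⊎-dec_; from-yes)

-- Sums over Fin n

∑-neg : ∀ {n} (f : Fin n → ℤ) → ∑[ i < n ] (- f i) ≡ - ∑[ i < n ] f i
∑-neg {n} f = begin
  ∑[ i < n ] (- f i)           ≡⟨ sum-cong-≗ (λ i → ℤ.-1*i≡-i (f i)) ⟨
  ∑[ i < n ] (- + 1 * f i)     ≡⟨ *-distribˡ-sum (- + 1) f ⟨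
  - + 1 * ∑[ i < n ] f i       ≡⟨ ℤ.-1*i≡-i (sum f) ⟩
  - ∑[ i < n ] f i             ∎
  where open ≡-Reasoning

∑-nonPos : ∀ {n} (f : Fin n → ℤ) → (∀ i → f i ≤ + 0) → sum f ≤ + 0
∑-nonPos {zero}  f f≤0 = ℤ.≤-refl
∑-nonPos {suc n} f f≤0 = ℤ.+-mono-≤ (f≤0 zero) (∑-nonPos (f ∘ suc) (f≤0 ∘ suc))

i≡-i⇒i≡0 : ∀ {i} → i ≡ - i → i ≡ + 0
i≡-i⇒i≡0 {+ zero} _ = refl

-- Swapping the two summations turns the sum into its own negative.
∑∑-antisym : ∀ {n} (a : Fin n → Fin n → ℤ) → (∀ u v → a u v ≡ - a v u) →
             ∑[ u < n ] ∑[ v < n ] a u v ≡ + 0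
∑∑-antisym {n} a anti = i≡-i⇒i≡0 (begin
  ∑[ u < n ] ∑[ v < n ] a u v      ≡⟨ sum-cong-≗ (λ u → trans (sum-cong-≗ (anti u)) (∑-neg λ v → a v u)) ⟩
  ∑[ u < n ] (- ∑[ v < n ] a v u)  ≡⟨ ∑-neg (λ u → ∑[ v < n ] a v u) ⟩
  - ∑[ u < n ] ∑[ v < n ] a v u    ≡⟨ cong -_ (∑-comm λ u v → a v u) ⟩
  - ∑[ u < n ] ∑[ v < n ] a u v    ∎)
  where open ≡-Reasoning

foldr-tabulate : ∀ {N n} (D : Fin N → ℤ) (f : Fin n → Fin N) →
                 foldr _+_ (+ 0) (map D (List.tabulate f)) ≡ sum (D ∘ f)
foldr-tabulate {n = zero}  D f = refl
foldr-tabulate {n = suc n} D f = cong (_+_ (D (f zero))) (foldr-tabulate D (f ∘ suc))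

ℕsum-tabulate : ∀ {N n} (g : Fin N → ℕ) (f : Fin n → Fin N) →
                + ℕ.sum (map g (List.tabulate f)) ≡ sum (λ i → + g (f i))
ℕsum-tabulate {n = zero}  g f = refl
ℕsum-tabulate {n = suc n} g f = trans (ℤ.pos-+ (g (f zero)) _) (cong (_+_ (+ g (f zero))) (ℕsum-tabulate g (f ∘ suc)))

Vecsum-tabulate : ∀ {n} (f : Fin n → ℕ) → + Vec.sum (tabulate f) ≡ sum (λ i → + f i)
Vecsum-tabulate {zero}  f = refl
Vecsum-tabulate {suc n} f = trans (ℤ.pos-+ (f zero) _) (cong (_+_ (+ f zero)) (Vecsum-tabulate (f ∘ suc)))

-- Enumeration of effective divisors

-- Vectors, because divisors are functions and can be matched with a finite list only up to
-- pointwise equality. There are binomial(n + d, d) entries: 66 for `vecs≤ 10 2` and 3003 for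
-- `vecs≤ 10 5`.
vecs≤ : ∀ n → ℕ → List (Vec ℕ n)
vecs≤ zero    d = [] ∷ []
vecs≤ (suc n) d = concatMap (λ x → map (x ∷_) (vecs≤ n (d ℕ.∸ x))) (upTo (suc d))

∈-vecs≤ : ∀ {n d} (x : Vec ℕ n) → Vec.sum x ℕ.≤ d → x ∈ vecs≤ n d
∈-vecs≤ []       _   = here refl
∈-vecs≤ {suc n} {d} (x ∷ xs) sum≤d =
  ∈-concatMap⁺ (λ y → map (y ∷_) (vecs≤ n (d ℕ.∸ y)))
    (lose (∈-upTo⁺ (s≤s (ℕ.m+n≤o⇒m≤o x sum≤d))) (∈-map⁺ (x ∷_) (∈-vecs≤ xs xs≤d∸x)))
  where
  xs≤d∸x : Vec.sum xs ℕ.≤ d ℕ.∸ x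
  xs≤d∸x = ℕ.m+n≤o⇒m≤o∸n (Vec.sum xs) (subst (ℕ._≤ d) (ℕ.+-comm x (Vec.sum xs)) sum≤d)

-- Single chips

δ : ∀ {n} → Fin n → Fin n → ℤ
δ v w = if does (w Fin.≟ v) then + 1 else + 0

∑-δ : ∀ {n} (v : Fin n) → sum (δ v) ≡ + 1
∑-δ {suc n} zero    = cong (_+_ (+ 1)) (sum-replicate-zero n)
∑-δ {suc n} (suc v) = trans (ℤ.+-identityˡ (sum (δ v))) (∑-δ v)

0≤δ : ∀ {n} (v w : Fin n) → + 0 ≤ δ v w
0≤δ v w with does (w Fin.≟ v)
... | true  = +≤+ z≤n
... | false = +≤+ z≤n

module _ {N : ℕ} (G : Graph N) where

  deg≡∑ : ∀ D → deg G D ≡ sum D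
  deg≡∑ D = foldr-tabulate D (λ v → v)

  deg-− : ∀ D E → deg G (_−_ G D E) ≡ deg G D - deg G E
  deg-− D E = begin
    deg G (_−_ G D E)              ≡⟨ deg≡∑ (_−_ G D E) ⟩
    ∑[ v < N ] (D v - E v)         ≡⟨ ∑-distrib-+ D (λ v → - E v) ⟩
    sum D + ∑[ v < N ] (- E v)     ≡⟨ cong (_+_ (sum D)) (∑-neg E) ⟩
    sum D - sum E                  ≡⟨ cong₂ _-_ (deg≡∑ D) (deg≡∑ E) ⟨
    deg G D - deg G E              ∎
    where open ≡-Reasoning

  effective-enum : ∀ X d → Effective G X → deg G X ≤ + d →
                   ∃ λ x → x ∈ vecs≤ N d × (∀ v → + lookup x v ≡ X v)
  effective-enum X d X≥0 degX≤d = tabulate f , ∈-vecs≤ (tabulate f) (ℤ.drop‿+≤+ sum≤d) ,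
    λ v → trans (cong +_ (Vec.lookup∘tabulate f v)) (∣X∣ v)
    where
    f : Fin N → ℕ
    f v = ∣ X v ∣
    ∣X∣ : ∀ v → + ∣ X v ∣ ≡ X v
    ∣X∣ v = ℤ.0≤i⇒+∣i∣≡i (X≥0 v)
    open ℤ.≤-Reasoning
    sum≤d : + Vec.sum (tabulate f) ≤ + d
    sum≤d = begin
      + Vec.sum (tabulate f) ≡⟨ Vecsum-tabulate f ⟩
      sum (λ v → + f v)      ≡⟨ sum-cong-≗ ∣X∣ ⟩
      sum X                  ≡⟨ deg≡∑ X ⟨
      deg G X                ≤⟨ degX≤d ⟩
      + d                    ∎

  fireAll : List (Fin N) → Divisor G → Divisor G
  fireAll vs D = foldr (fire G) D vs

  ∼-fireAll : ∀ vs D → _∼_ G D (fireAll vs D)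
  ∼-fireAll []       D = EqClosure.reflexive _
  ∼-fireAll (v ∷ vs) D = EqClosure.transitive _ (∼-fireAll vs D) (EqClosure.return (v , λ w → refl))

  fireAll-cong : ∀ vs {D D'} → D ≗ D' → fireAll vs D ≗ fireAll vs D'
  fireAll-cong []       D≗D' w = D≗D' w
  fireAll-cong (v ∷ vs) D≗D' w with w Fin.≟ v
  ... | yes _ = cong (_- + val G v) (fireAll-cong vs D≗D' v)
  ... | no  _ = cong (_+ + edges G v w) (fireAll-cong vs D≗D' w)

  -- Linear equivalence through the Laplacian

  -- For symmetric edges, the net gain of `w` when each `u` fires `σ u` times: the negative of the
  -- usual Laplacian. In this form loops visibly contribute nothing.
  Δ : (Fin N → ℤ) → Divisor G
  Δ σ w = ∑[ u < N ] ((σ u - σ w) * + edges G u w)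

  infix 4 _≈_
  -- Unlike a chain of firings and inverse firings, a single script `σ` has a maximum, which is
  -- where the burning argument looks.
  record _≈_ (D D' : Divisor G) : Set where
    constructor firing
    field
      σ     : Fin N → ℤ
      D'-D  : ∀ w → D' w - D w ≡ Δ σ w

  -- Chips can be moved across an equivalence: `X ≈ D − E` yields `X + E − E' ≈ D − E'`.
  ≈-resp-difference : ∀ {A B D D'} → (∀ w → B w - A w ≡ D' w - D w) → D ≈ D' → A ≈ B
  ≈-resp-difference eq (firing σ D'-D) = firing σ λ w → trans (eq w) (D'-D w)

  ≗⇒≈ : ∀ {D D'} → D ≗ D' → D ≈ D'
  ≗⇒≈ {D} {D'} D≗D' = firing (λ _ → + 0) λ w → begin
    D' w - D w                         ≡⟨ cong (λ x → D' w - x) (D≗D' w) ⟩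
    D' w - D' w                        ≡⟨ ℤ.+-inverseʳ (D' w) ⟩
    + 0                                ≡⟨ sum-replicate-zero N ⟨
    ∑[ u < N ] (+ 0)                   ≡⟨⟩
    Δ (λ _ → + 0) w                    ∎
    where open ≡-Reasoning

  ≈-sym : ∀ {D D'} → D ≈ D' → D' ≈ D
  ≈-sym {D} {D'} (firing σ D'-D) = firing (λ v → - σ v) λ w → begin
    D w - D' w                                      ≡⟨ swap (D w) (D' w) ⟩
    - (D' w - D w)                                  ≡⟨ cong -_ (D'-D w) ⟩
    - Δ σ w                                         ≡⟨ ∑-neg (λ u → (σ u - σ w) * + edges G u w) ⟨
    ∑[ u < N ] (- ((σ u - σ w) * + edges G u w))    ≡⟨ sum-cong-≗ (λ u → push (σ u) (σ w) (+ edges G u w)) ⟩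
    Δ (λ v → - σ v) w                               ∎
    where
    open ≡-Reasoning
    swap : ∀ a b → a - b ≡ - (b - a)
    swap = solve-∀
    push : ∀ a b e → - ((a - b) * e) ≡ (- a - - b) * e
    push = solve-∀

  ≈-trans : ∀ {D D' D''} → D ≈ D' → D' ≈ D'' → D ≈ D''
  ≈-trans {D} {D'} {D''} (firing σ D'-D) (firing τ D''-D') = firing (λ v → σ v + τ v) λ w → begin
    D'' w - D w                    ≡⟨ split (D w) (D' w) (D'' w) ⟩
    (D' w - D w) + (D'' w - D' w)  ≡⟨ cong₂ _+_ (D'-D w) (D''-D' w) ⟩
    Δ σ w + Δ τ w                  ≡⟨ ∑-distrib-+ (λ u → (σ u - σ w) * + edges G u w) _ ⟨
    ∑[ u < N ] ((σ u - σ w) * + edges G u w + (τ u - τ w) * + edges G u w)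
                                   ≡⟨ sum-cong-≗ (λ u → merge (σ u) (σ w) (τ u) (τ w) (+ edges G u w)) ⟩
    Δ (λ v → σ v + τ v) w          ∎
    where
    open ≡-Reasoning
    split : ∀ a b c → c - a ≡ (b - a) + (c - b)
    split = solve-∀
    merge : ∀ a b c d e → (a - b) * e + (c - d) * e ≡ ((a + c) - (b + d)) * e
    merge = solve-∀

  ≈-isEquivalence : IsEquivalence _≈_
  ≈-isEquivalence = record { refl = ≗⇒≈ (λ _ → refl) ; sym = ≈-sym ; trans = ≈-trans }

  -- Dhar's burning algorithm

  burntDeg : Subset N → Fin N → ℤ
  burntDeg S v = ∑[ w < N ] (if lookup S w then + edges G w v else + 0)

  ignite : Divisor G → Subset N → Subset N
  ignite F S = tabulate λ v → lookup S v ∨ does (F v <? burntDeg S v)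

  -- No source vertex is chosen: `burntDeg ⊥` is 0, so the first round ignites exactly the vertices
  -- in debt.
  burn : ℕ → Divisor G → Subset N
  burn zero    F = ⊥
  burn (suc k) F = ignite F (burn k F)

  module _ {F Y : Divisor G} (F≈Y : F ≈ Y) (Y≥0 : Effective G Y) (p : Fin N) where

    private
      σ : Fin N → ℤ
      σ = _≈_.σ F≈Y

      m : Fin N
      -- `p` starts the search and guarantees that there is a vertex; for `N = 0`, `⊥` and `⊤` would
      -- coincide.
      m = argmax σ p (allFin N)

      σ≤σm : ∀ v → σ v ≤ σ m
      σ≤σm v = All.lookup (f[xs]≤f[argmax] {f = σ} p (allFin N)) (∈-allFin v)

    -- At a maximum v of σ, each burnt neighbour takes at least one chip per edge.
    ignite-maximum : ∀ S v → (∀ u → lookup S u ≡ true → σ u < σ m) → F v < burntDeg S v → σ v < σ m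
    -- If `σ m ≤ σ v`, then from `F` to `Y` the vertex `v` loses at least `burntDeg S v` chips, more
    -- than `F v`, so `Y v` would be negative.
    ignite-maximum S v burnt<max Fv<burntDeg = ℤ.≰⇒> λ σm≤σv → ℤ.<-irrefl refl (begin-strict
      + 0                                   ≤⟨ Y≥0 v ⟩
      Y v                                   ≡⟨ regroup (F v) (Y v) (burntDeg S v) ⟩
      F v + ((Y v - F v) + burntDeg S v) - burntDeg S v
                                            ≤⟨ ℤ.+-monoˡ-≤ (- burntDeg S v) (ℤ.+-monoʳ-≤ (F v) (Δ+burntDeg≤0 σm≤σv)) ⟩
      F v + + 0 - burntDeg S v              ≡⟨ cong (_- burntDeg S v) (ℤ.+-identityʳ (F v)) ⟩
      F v - burntDeg S v                    <⟨ ℤ.+-monoˡ-< (- burntDeg S v) Fv<burntDeg ⟩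
      burntDeg S v - burntDeg S v           ≡⟨ ℤ.+-inverseʳ (burntDeg S v) ⟩
      + 0                                   ∎)
      where
      open ℤ.≤-Reasoning
      regroup : ∀ f y b → y ≡ f + ((y - f) + b) - b
      regroup = solve-∀
      a+e≡[1+a]*e : ∀ a b e → (a - b) * e + e ≡ (+ 1 + a - b) * e
      a+e≡[1+a]*e = solve-∀
      nonPos-*-edges : ∀ {i} u → i ≤ + 0 → i * + edges G u v ≤ + 0
      nonPos-*-edges u i≤0 = ℤ.*-monoʳ-≤-nonNeg (+ edges G u v) i≤0
      term : σ m ≤ σ v → ∀ u → (σ u - σ v) * + edges G u v + (if lookup S u then + edges G u v else + 0) ≤ + 0
      term σm≤σv u with lookup S u in u∈S
      ... | true  = subst (_≤ + 0) (sym (a+e≡[1+a]*e (σ u) (σ v) (+ edges G u v)))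
              (nonPos-*-edges u (ℤ.i≤j⇒i-j≤0 (ℤ.i<j⇒suc[i]≤j (ℤ.<-≤-trans (burnt<max u u∈S) σm≤σv))))
      ... | false = subst (_≤ + 0) (sym (ℤ.+-identityʳ ((σ u - σ v) * + edges G u v)))
              (nonPos-*-edges u (ℤ.i≤j⇒i-j≤0 (ℤ.≤-trans (σ≤σm u) σm≤σv)))
      Δ+burntDeg≤0 : σ m ≤ σ v → (Y v - F v) + burntDeg S v ≤ + 0
      Δ+burntDeg≤0 σm≤σv = begin
        (Y v - F v) + burntDeg S v   ≡⟨ cong (_+ burntDeg S v) (_≈_.D'-D F≈Y v) ⟩
        Δ σ v + burntDeg S v         ≡⟨ ∑-distrib-+ (λ u → (σ u - σ v) * + edges G u v) _ ⟨
        ∑[ u < N ] ((σ u - σ v) * + edges G u v + (if lookup S u then + edges G u v else + 0))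
                                     ≤⟨ ∑-nonPos _ (term σm≤σv) ⟩
        + 0                          ∎

    -- Induction on the rounds, with `ignite-maximum` handling each newly lit vertex.
    burnt<max : ∀ k v → lookup (burn k F) v ≡ true → σ v < σ m
    burnt<max zero    v v∈⊥ = contradiction (trans (sym v∈⊥) (Vec.lookup-replicate v false)) λ ()
    burnt<max (suc k) v v∈S
      -- The third scrutinee equates `true` with the disjunction in `ignite`; when both disjuncts
      -- are false it is absurd.
      with lookup (burn k F) v in v∈burn | F v <? burntDeg (burn k F) v
         | trans (sym v∈S) (Vec.lookup∘tabulate _ v)
    ... | true  | _              | _  = burnt<max k v v∈burn
    ... | false | yes Fv<burntDeg | _ = ignite-maximum (burn k F) v (burnt<max k) Fv<burntDeg
    ... | false | no _           | ()

    -- A complete fire would put the maximum of `σ` strictly below itself.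
    effective⇒unburnt : ∀ k → burn k F ≢ ⊤
    effective⇒unburnt k burn≡⊤ = ℤ.<-irrefl refl
      (burnt<max k m (trans (cong (λ S → lookup S m) burn≡⊤) (Vec.lookup-replicate m true)))

  -- Undirected graphs

  module _ (edges-sym : ∀ u v → edges G u v ≡ edges G v u) where

    -- `val` sums the edges leaving the fired vertex, `Δ` those entering it; symmetry identifies the
    -- two. Away from `v` only the term `u = v` survives.
    Δ-δ : ∀ D v w → fire G v D w - D w ≡ Δ (δ v) w
    Δ-δ D v w with w Fin.≟ v
    ... | yes refl = begin
      (D w - + val G w) - D w              ≡⟨ cancel (D w) (+ val G w) ⟩
      - + val G w                          ≡⟨ cong -_ (ℕsum-tabulate m (λ u → u)) ⟩
      - ∑[ u < N ] (+ m u)                 ≡⟨ ∑-neg (λ u → + m u) ⟨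
      ∑[ u < N ] (- + m u)                 ≡⟨ sum-cong-≗ term ⟩
      ∑[ u < N ] ((δ w u - + 1) * + edges G u w) ∎
      where
      open ≡-Reasoning
      m : Fin N → ℕ
      m u = if does (u Fin.≟ w) then 0 else edges G w u
      cancel : ∀ a b → (a - b) - a ≡ - b
      cancel = solve-∀
      term : ∀ u → - + m u ≡ (δ w u - + 1) * + edges G u w
      term u with does (u Fin.≟ w)
      ... | true  = refl
      ... | false = trans (cong (λ e → - + e) (edges-sym w u)) (sym (ℤ.-1*i≡-i (+ edges G u w)))
    ... | no _ = begin
      (D w + + edges G v w) - D w                  ≡⟨ cancel (D w) (+ edges G v w) ⟩
      + edges G v w                                ≡⟨ ℤ.*-identityˡ (+ edges G v w) ⟨
      + 1 * + edges G v w                          ≡⟨ cong (_* + edges G v w) (∑-δ v) ⟨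
      sum (δ v) * + edges G v w                    ≡⟨ *-distribʳ-sum (+ edges G v w) (δ v) ⟩
      ∑[ u < N ] (δ v u * + edges G v w)           ≡⟨ sum-cong-≗ term ⟩
      ∑[ u < N ] ((δ v u - + 0) * + edges G u w)   ∎
      where
      open ≡-Reasoning
      cancel : ∀ a b → (a + b) - a ≡ b
      cancel = solve-∀
      term : ∀ u → δ v u * + edges G v w ≡ (δ v u - + 0) * + edges G u w
      term u with u Fin.≟ v
      ... | yes refl = refl
      ... | no _     = refl

    ∼⇒≈ : ∀ {D D'} → _∼_ G D D' → D ≈ D'
    ∼⇒≈ = EqClosure.fold ≈-isEquivalence
      λ { {D} (v , D'≗fire) → firing (δ v) λ w → trans (cong (_- D w) (D'≗fire w)) (Δ-δ D v w) }

    -- The net flow from `u` to `w` is the negative of that from `w` to `u`, so `Δ σ` sums to 0.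
    deg-cong-≈ : ∀ {D D'} → D ≈ D' → deg G D ≡ deg G D'
    deg-cong-≈ {D} {D'} (firing σ D'-D) = begin
      deg G D                            ≡⟨ deg≡∑ D ⟩
      sum D                              ≡⟨ ℤ.+-identityʳ (sum D) ⟨
      sum D + + 0                        ≡⟨ cong (_+_ (sum D)) (∑∑-antisym _ anti) ⟨
      sum D + sum (Δ σ)                  ≡⟨ ∑-distrib-+ D (Δ σ) ⟨
      ∑[ w < N ] (D w + Δ σ w)           ≡⟨ sum-cong-≗ (λ w → cong (_+_ (D w)) (D'-D w)) ⟨
      ∑[ w < N ] (D w + (D' w - D w))    ≡⟨ sum-cong-≗ (λ w → cancel (D w) (D' w)) ⟩
      sum D'                             ≡⟨ deg≡∑ D' ⟨
      deg G D'                           ∎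
      where
      open ≡-Reasoning
      cancel : ∀ a b → a + (b - a) ≡ b
      cancel = solve-∀
      swap : ∀ a b e → (a - b) * e ≡ - ((b - a) * e)
      swap = solve-∀
      anti : ∀ w u → (σ u - σ w) * + edges G u w ≡ - ((σ w - σ u) * + edges G w u)
      anti w u = trans (swap (σ u) (σ w) (+ edges G u w))
                       (cong (λ e → - ((σ w - σ u) * + e)) (edges-sym u w))

    -- `D` is known only through `X`, but `X + E − E'` is equivalent to `D − E'`, which the rank
    -- makes equivalent to an effective divisor. Firing `U` first stays in the class and may reach a
    -- representative on which the fire spreads further.
    rank2⇒unburnt : ∀ {D E X E' k x} U → Fin N → RankAtLeast G 2 D →
      _∼_ G (_−_ G D E) X → (∀ v → + lookup x v ≡ X v) →
      Effective G E' → deg G E' ≡ + 2 →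
      burn k (lookup (tabulate (fireAll U λ v → (+ lookup x v + E v) - E' v))) ≢ ⊤
    rank2⇒unburnt {D} {E} {X} {E'} {k} {x} U p rank D−E∼X x≗X E'≥0 degE'≡2 =
      let Y , D−E'∼Y , Y≥0 = rank 2 ℕ.≤-refl E' E'≥0 degE'≡2
          F≈B : lookup (tabulate (fireAll U B)) ≈ B
          F≈B = ≈-trans (≗⇒≈ (Vec.lookup∘tabulate (fireAll U B))) (≈-sym (∼⇒≈ (∼-fireAll U B)))
          B≈D−E' : B ≈ _−_ G D E'
          B≈D−E' = ≈-resp-difference difference (≈-sym (∼⇒≈ D−E∼X))
      in effective⇒unburnt (≈-trans F≈B (≈-trans B≈D−E' (∼⇒≈ D−E'∼Y))) Y≥0 p k
      where
      B : Divisor G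
      B v = (+ lookup x v + E v) - E' v
      cancel : ∀ d e e' x → (d - e') - ((x + e) - e') ≡ (d - e) - x
      cancel = solve-∀
      difference : ∀ v → (D v - E' v) - B v ≡ (D v - E v) - X v
      difference v = trans (cong (λ y → (D v - E' v) - ((y + E v) - E' v)) (x≗X v))
                           (cancel (D v) (E v) (E' v) (X v))

-- The crown graph

private
  a₀ b₀ : Fin 10
  a₀ = # 0
  b₀ = # 5

Cr10-sym : ∀ u v → edges Cr10 u v ≡ edges Cr10 v u
Cr10-sym = from-yes (Fin.all? λ u → Fin.all? λ v → edges Cr10 u v ℕ.≟ edges Cr10 v u)

-- Distances and the value of `α₂`

CommonNeighbour : Fin 10 → Fin 10 → Set
CommonNeighbour u v = ∃ λ w → 0 ℕ.< edges Cr10 u w × 0 ℕ.< edges Cr10 w v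

commonNeighbour? : ∀ u v → Dec (CommonNeighbour u v)
commonNeighbour? u v = Fin.any? λ w → (0 ℕ.<? edges Cr10 u w) ×-dec (0 ℕ.<? edges Cr10 w v)

commonNeighbour⇒DistLE2 : ∀ {u v} → CommonNeighbour u v → DistLE Cr10 u v 2
commonNeighbour⇒DistLE2 (w , uw , wv) = 2 , ℕ.≤-refl , cons {w = w} uw (cons wv nil)

abstract
  -- Two vertices on one side together miss at most two of the five opposite vertices, so they share
  -- at least three neighbours.
  commonNeighbour-among-three : ∀ u v w → CommonNeighbour u v ⊎ CommonNeighbour u w ⊎ CommonNeighbour v w
  commonNeighbour-among-three = from-yes (Fin.all? λ u → Fin.all? λ v → Fin.all? λ w →
    commonNeighbour? u v ⊎-dec commonNeighbour? u w ⊎-dec commonNeighbour? v w)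

far2Set-length≤2 : ∀ S → Far2Set Cr10 S → length S ℕ.≤ 2
far2Set-length≤2 []          _ = z≤n
far2Set-length≤2 (_ ∷ [])    _ = s≤s z≤n
far2Set-length≤2 (_ ∷ _ ∷ []) _ = s≤s (s≤s z≤n)
far2Set-length≤2 (u ∷ v ∷ w ∷ _) ((u≢v ∷ u≢w ∷ _) ∷ (v≢w ∷ _) ∷ _ , far)
  with commonNeighbour-among-three u v w
... | inj₁ uv        = contradiction (commonNeighbour⇒DistLE2 uv) (far (here refl) (there (here refl)) u≢v)
... | inj₂ (inj₁ uw) = contradiction (commonNeighbour⇒DistLE2 uw) (far (here refl) (there (there (here refl))) u≢w)
... | inj₂ (inj₂ vw) = contradiction (commonNeighbour⇒DistLE2 vw) (far (there (here refl)) (there (there (here refl))) v≢w)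

¬DistLE2 : ∀ {u v} → u ≢ v → edges Cr10 u v ≡ 0 → ¬ CommonNeighbour u v → DistGT2 Cr10 u v
¬DistLE2 u≢v _ _ (_ , _ , nil) = u≢v refl
¬DistLE2 _ uv≡0 _ (_ , _ , cons uv nil) = ℕ.n≮0 (subst (0 ℕ.<_) uv≡0 uv)
¬DistLE2 _ _ ¬common (_ , _ , cons {w = w} uw (cons wv nil)) = ¬common (w , uw , wv)
¬DistLE2 _ _ _ (_ , s≤s (s≤s ()) , cons _ (cons _ (cons _ _)))

far2Set-a₀b₀ : Far2Set Cr10 (a₀ ∷ b₀ ∷ [])
far2Set-a₀b₀ = (((λ ()) ∷ []) ∷ [] ∷ []) , far
  where
  far : ∀ {u v} → u ∈ a₀ ∷ b₀ ∷ [] → v ∈ a₀ ∷ b₀ ∷ [] → u ≢ v → DistGT2 Cr10 u v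
  far (here refl)         (here refl)         u≢v = contradiction refl u≢v
  far (here refl)         (there (here refl)) u≢v = ¬DistLE2 u≢v refl (from-yes (¬? (commonNeighbour? a₀ b₀)))
  far (there (here refl)) (here refl)         u≢v = ¬DistLE2 u≢v refl (from-yes (¬? (commonNeighbour? b₀ a₀)))
  far (there (here refl)) (there (here refl)) u≢v = contradiction refl u≢v

alpha₂≡2 : IsAlpha2 Cr10 2
alpha₂≡2 = (a₀ ∷ b₀ ∷ [] , far2Set-a₀b₀ , refl) , far2Set-length≤2

chips₂ : Fin 10 → Fin 10 → Divisor Cr10
chips₂ i j v = δ i v + δ j v

chips₂-effective : ∀ i j → Effective Cr10 (chips₂ i j)
chips₂-effective i j v = ℤ.+-mono-≤ (0≤δ i v) (0≤δ j v)

deg-chips₂ : ∀ i j → deg Cr10 (chips₂ i j) ≡ + 2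
deg-chips₂ i j = begin
  deg Cr10 (chips₂ i j)                  ≡⟨ deg≡∑ Cr10 (chips₂ i j) ⟩
  sum (chips₂ i j)                       ≡⟨ ∑-distrib-+ (δ i) (δ j) ⟩
  sum (δ i) + sum (δ j)                  ≡⟨ cong₂ _+_ (∑-δ i) (∑-δ j) ⟩
  + 2                                    ∎
  where open ≡-Reasoning

-- Upper bound

V−a₀−b₀ : Divisor Cr10
V−a₀−b₀ v = + 1 - chips₂ a₀ b₀ v

allExcept : List (Fin 10) → List (Fin 10)
allExcept S = filter (λ v → ¬? (any? (v Fin.≟_) S)) (allFin 10)

-- Firing every vertex once changes nothing, so firing `allExcept S` amounts to borrowing at each
-- vertex of `S`. The case `v = a₀` or `v = b₀` includes borrowing at a single vertex.
firingSets : List (List (Fin 10))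
firingSets = [] ∷ concatMap (λ v → allExcept (a₀ ∷ v ∷ []) ∷ allExcept (b₀ ∷ v ∷ []) ∷ []) (allFin 10)

EffectiveAfterFiring : Vec ℕ 10 → List (Fin 10) → Set
EffectiveAfterFiring x U = Effective Cr10 (fireAll Cr10 U λ v → V−a₀−b₀ v - + lookup x v)

effectiveAfterFiring? : ∀ x U → Dec (EffectiveAfterFiring x U)
effectiveAfterFiring? x U = Fin.all? λ v → + 0 ≤? fireAll Cr10 U (λ w → V−a₀−b₀ w - + lookup x w) v

abstract
  effective-after-firing : All (λ x → Any (EffectiveAfterFiring x) firingSets) (vecs≤ 10 2)
  effective-after-firing = from-yes (All.all? (λ x → any? (effectiveAfterFiring? x) firingSets) (vecs≤ 10 2))

rank-V−a₀−b₀ : RankAtLeast Cr10 2 V−a₀−b₀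
rank-V−a₀−b₀ k k≤2 E E≥0 degE≡k =
  -- The list contains every degree up to 2, so one check serves all `k`.
  let x , x∈vecs , x≗E = effective-enum Cr10 E 2 E≥0 (subst (_≤ + 2) (sym degE≡k) (+≤+ k≤2))
      U , F≥0 = satisfied (All.lookup effective-after-firing x∈vecs)
  in fireAll Cr10 U (_−_ Cr10 V−a₀−b₀ E) , ∼-fireAll Cr10 U _ ,
     λ v → subst (+ 0 ≤_) (fireAll-cong Cr10 U (λ w → cong (_-_ (V−a₀−b₀ w)) (x≗E w)) v) (F≥0 v)

-- Lower bound

-- Removing two chips beforehand cuts the enumeration from the 19448 effective divisors of degree at
-- most 7 to the 3003 of degree at most 5.
a₀+a₁ : Divisor Cr10
a₀+a₁ = chips₂ (# 0) (# 1)

record Certificate : Set where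
  constructor subtract_,_fire_
  field
    i j : Fin 10
    U   : List (Fin 10)

-- Found by computer search, the certificates that apply most often first.
certificates : List Certificate
certificates =
    (subtract # 2 , # 3 fire [])          ∷ (subtract # 4 , # 5 fire [])
  ∷ (subtract # 0 , # 7 fire [])          ∷ (subtract # 2 , # 3 fire (# 1 ∷ []))
  ∷ (subtract # 8 , # 9 fire [])          ∷ (subtract # 2 , # 3 fire (# 0 ∷ []))
  ∷ (subtract # 6 , # 7 fire [])          ∷ (subtract # 1 , # 4 fire [])
  ∷ (subtract # 0 , # 0 fire (# 2 ∷ []))  ∷ (subtract # 0 , # 0 fire (# 3 ∷ []))
  ∷ (subtract # 0 , # 0 fire (# 4 ∷ []))  ∷ (subtract # 0 , # 0 fire (# 5 ∷ []))
  ∷ (subtract # 0 , # 2 fire (# 7 ∷ []))  ∷ (subtract # 0 , # 3 fire (# 8 ∷ []))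
  ∷ (subtract # 0 , # 4 fire (# 9 ∷ []))  ∷ (subtract # 1 , # 1 fire (# 6 ∷ []))
  ∷ []

-- Passing through a vector computes each value of the fired divisor only once.
Burns : Vec ℕ 10 → Certificate → Set
Burns x (subtract i , j fire U) =
  burn Cr10 10 (lookup (tabulate (fireAll Cr10 U λ v → (+ lookup x v + a₀+a₁ v) - chips₂ i j v))) ≡ ⊤

burns? : ∀ x c → Dec (Burns x c)
burns? x c = Vec.≡-dec Bool._≟_ _ ⊤

abstract
  every-divisor-burns : All (λ x → Any (Burns x) certificates) (vecs≤ 10 5)
  every-divisor-burns = from-yes (All.all? (λ x → any? (burns? x) certificates) (vecs≤ 10 5))

¬burns : ∀ {D X x} → RankAtLeast Cr10 2 D → _∼_ Cr10 (_−_ Cr10 D a₀+a₁) X → (∀ v → + lookup x v ≡ X v) →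
         ∀ c → ¬ Burns x c
¬burns {D} {X} {x} rank D−a₀−a₁∼X x≗X (subtract i , j fire U) =
  -- Every round before the fire stops ignites a new vertex, so ten rounds settle whether all ten
  -- burn.
  rank2⇒unburnt Cr10 Cr10-sym {D} {a₀+a₁} {k = 10} {x} U a₀ rank D−a₀−a₁∼X x≗X
    (chips₂-effective i j) (deg-chips₂ i j)

rank2⇒8≤deg : ∀ D → RankAtLeast Cr10 2 D → + 8 ≤ deg Cr10 D
rank2⇒8≤deg D rank = ℤ.≮⇒≥ λ deg<8 →
  -- The rank is used here to obtain `X`, and again inside `¬burns` against the chips of the
  -- certificate.
  let X , D−a₀−a₁∼X , X≥0 = rank 2 ℕ.≤-refl a₀+a₁ (chips₂-effective (# 0) (# 1)) (deg-chips₂ (# 0) (# 1))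
      x , x∈vecs , x≗X = effective-enum Cr10 X 5 X≥0 (degX≤5 deg<8 D−a₀−a₁∼X)
      c , burns = satisfied (All.lookup every-divisor-burns x∈vecs)
  in ¬burns {D} {X} {x} rank D−a₀−a₁∼X x≗X c burns
  where
  open ℤ.≤-Reasoning
  degX≤5 : ∀ {X} → deg Cr10 D < + 8 → _∼_ Cr10 (_−_ Cr10 D a₀+a₁) X → deg Cr10 X ≤ + 5
  degX≤5 {X} deg<8 D−a₀−a₁∼X = begin
    deg Cr10 X                       ≡⟨ deg-cong-≈ Cr10 Cr10-sym (∼⇒≈ Cr10 Cr10-sym D−a₀−a₁∼X) ⟨
    deg Cr10 (_−_ Cr10 D a₀+a₁)      ≡⟨ deg-− Cr10 D a₀+a₁ ⟩
    deg Cr10 D - deg Cr10 a₀+a₁      ≤⟨ ℤ.+-monoˡ-≤ (- deg Cr10 a₀+a₁) (ℤ.i<j⇒i≤pred[j] deg<8) ⟩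
    + 7 - deg Cr10 a₀+a₁             ≡⟨ cong (_-_ (+ 7)) (deg-chips₂ (# 0) (# 1)) ⟩
    + 5                              ∎

theorem3p3 : Σ ℕ λ a → IsAlpha2 Cr10 a × IsGon2 Cr10 (+ 10 - + a)
-- Both `+ 10 - + 2` and the degree of `V−a₀−b₀` evaluate to `+ 8`.
theorem3p3 = 2 , alpha₂≡2 , (V−a₀−b₀ , rank-V−a₀−b₀ , refl) , rank2⇒8≤deg
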